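{- Let $G$ be a distance-regular graph of diameter $d$ which is an antipodal double cover. If $l$ is a distance magic labeling or a closed distance magic labeling of $G$, then $l$ is a $\{j,d-j\}$-magic labeling of $G$ for every $j\in\{0,1,\dots,d\}$. Moreover, if $G$ is bipartite and $l$ is a distance magic labeling, then $d\equiv 2\pmod 4$.
   Context: A connected graph $G$ of diameter $d$ is distance-regular if there are non-negative integers $b_i,c_i$ ($0\le i\le d$) such that for any two vertices $x,y$ at distance $i$, $y$ has exactly $c_i$ neighbours at distance $i-1$ from $x$ and exactly $b_i$ neighbours at distance $i+1$ from $x$. For a vertex $x$, $G_i(x)$ is the set of vertices at distance $i$ from $x$. $G$ is an antipodal double cover if $|G_d(x)|=1$ for every vertex $x$. For a set of distances $D$, $N_D(x)=\bigcup_{i\in D}G_i(x)$. For $G$ of order $N$, a $D$-magic labeling is a bijection $f:V(G)\to\{1,\dots,N\}$ such that $\sum_{y\in N_D(x)}f(y)$ is the same constant for every vertex $x$. A distance magic labeling is a $\{1\}$-magic labeling and a closed distance magic labeling is a $\{0,1\}$-magic labeling.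
   Formalization: In the "Moreover" part the diameter is assumed to be at least 1; this excludes only the one-vertex graph (d = 0), which meets all the stated conditions literally but for which d ≡ 2 (mod 4) fails. -}

module Defs where

open import Data.Bool.Base using (Bool)
open import Data.Fin.Base using (Fin; toℕ)
open import Data.Fin.Properties using (_≟_; any?)
open import Data.Fin.Subset using (Subset; _∩_; ⋃; ⊥; ∣_∣)
open import Data.Fin.Subset.Properties using (_∈?_)
open import Data.List.Base as List using (List; []; _∷_; allFin; filter; sum)
open import Data.Nat.Base using (ℕ; zero; suc; _≤_; _<_)
open import Data.Nat.Properties using (allUpTo?)
open import Data.Product.Base using (∃; ∃₂; _×_; _,_)
open import Data.Vec.Base using (tabulate)
open import Function.Bundles using (_⤖_; Bijection)
open import Level using (0ℓ)
open import Relation.Binary.Core using (Rel)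
open import Relation.Binary.Definitions using (Symmetric; Irreflexive)
import Relation.Binary.Definitions as Binary
open import Relation.Binary.PropositionalEquality.Core using (_≡_; _≢_; refl)
open import Relation.Nullary.Decidable using (Dec; does; map′; ¬?; _×-dec_)
open import Relation.Nullary.Negation using (¬_)
open import Relation.Unary using (Pred; Decidable)

-- Finite simple graph on the vertex set Fin n.
record Graph (n : ℕ) : Set₁ where
  field
    Adj    : Rel (Fin n) 0ℓ
    adj?   : Binary.Decidable Adj
    sym    : Symmetric Adj
    irrefl : Irreflexive _≡_ Adj

subset : ∀ {n} {P : Pred (Fin n) 0ℓ} → Decidable P → Subset n
subset P? = tabulate λ x → does (P? x)

sumOver : ∀ {n} → Subset n → (Fin n → ℕ) → ℕ
sumOver {n} S f = sum (List.map f (filter (_∈? S) (allFin n)))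

module _ {n : ℕ} (G : Graph n) where
  open Graph G

  data Walk : ℕ → Fin n → Fin n → Set where
    nil  : ∀ {x} → Walk zero x x
    cons : ∀ {k x y z} → Adj x y → Walk k y z → Walk (suc k) x z

  walk? : ∀ k x y → Dec (Walk k x y)
  walk? zero    x y = map′ (λ { refl → nil }) (λ { nil → refl }) (x ≟ y)
  walk? (suc k) x z =
    map′ (λ { (_ , a , w) → cons a w }) (λ { (cons a w) → _ , a , w })
         (any? λ y → adj? x y ×-dec walk? k y z)

  Connected : Set
  Connected = ∀ x y → ∃ λ k → Walk k x y

  -- "x and y are at distance k".  A shortest walk is a path, so this is the
  -- usual shortest-path distance.
  Distance : ℕ → Fin n → Fin n → Set
  Distance k x y = Walk k x y × (∀ {m} → m < k → ¬ Walk m x y)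

  distance? : ∀ k x y → Dec (Distance k x y)
  distance? k x y = walk? k x y ×-dec allUpTo? (λ m → ¬? (walk? m x y)) k

  HasDiameter : ℕ → Set
  HasDiameter d = (∃₂ λ x y → Distance d x y)
                × (∀ x y k → Distance k x y → k ≤ d)

  neighbours : Fin n → Subset n
  neighbours y = subset (adj? y)

  -- G_i(x)
  sphere : ℕ → Fin n → Subset n
  sphere i x = subset (distance? i x)

  -- G_{i-1}(x), with G_{-1}(x) empty
  spherePred : ℕ → Fin n → Subset n
  spherePred zero    x = ⊥
  spherePred (suc i) x = sphere i x

  record IsDistanceRegular (d : ℕ) : Set where
    field
      connected : Connected
      diameter  : HasDiameter d
      b c       : Fin (suc d) → ℕ
      c-count   : ∀ i x y → Distance (toℕ i) x y →
                  ∣ neighbours y ∩ spherePred (toℕ i) x ∣ ≡ c i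
      b-count   : ∀ i x y → Distance (toℕ i) x y →
                  ∣ neighbours y ∩ sphere (suc (toℕ i)) x ∣ ≡ b i

  -- To be used with d the diameter of G.
  IsAntipodalDoubleCover : ℕ → Set
  IsAntipodalDoubleCover d = ∀ x → ∣ sphere d x ∣ ≡ 1

  IsBipartite : Set
  IsBipartite = ∃ λ (colour : Fin n → Bool) → ∀ {x y} → Adj x y → colour x ≢ colour y

  -- N_D(x).  The list D stands for the set of its entries: the union is
  -- insensitive to order and repetition.
  neighbourhood : List ℕ → Fin n → Subset n
  neighbourhood D x = ⋃ (List.map (λ i → sphere i x) D)

Labeling : ℕ → Set
Labeling n = Fin n ⤖ Fin n

-- {1,…,n} is Fin n shifted by one.
label : ∀ {n} → Labeling n → Fin n → ℕ
label l x = suc (toℕ (Bijection.to l x))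

IsMagic : ∀ {n} → Graph n → List ℕ → Labeling n → Set
IsMagic G D l = ∃ λ κ → ∀ x → sumOver (neighbourhood G D x) (label l) ≡ κ

IsDistanceMagic : ∀ {n} → Graph n → Labeling n → Set
IsDistanceMagic G = IsMagic G (1 ∷ [])

IsClosedDistanceMagic : ∀ {n} → Graph n → Labeling n → Set
IsClosedDistanceMagic G = IsMagic G (0 ∷ 1 ∷ [])

{-# OPTIONS --safe #-}

-- Let f be the labeling, S_j(x) the sum of f over the sphere of radius j at x, and σ x the antipode
-- of x.  Summing ε f + S_1 = κ (ε = 0 or 1) over spheres and using the three-term recurrence for
-- distance matrices shows that, up to an additive constant, each S_j is a rational multiple of f.
-- To avoid fractions and constants this reads p (S_j x − S_j y) = q (f x − f y) with p > 0.  As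
-- S_d = f ∘ σ, taking y = σ x for j = d forces q = −p, so f + f ∘ σ is constant; then so is
-- S_j + S_j ∘ σ = S_j + S_{d−j}.  If G is bipartite and ε = 0, the middle coefficient of the
-- recurrence vanishes: S_j is constant for odd j, and the sign of q alternates along even j, so q < 0
-- only when j ≡ 2 (mod 4).

module Submission where

open import Defs
import Algebra.Properties.Semiring.Sum
open import Data.Bool.Base using (Bool; true; not; if_then_else_)
open import Data.Bool.Properties using (¬-not)
open import Data.Fin.Base as Fin using (Fin; toℕ; fromℕ<)
import Data.Fin.Properties as Fin
open import Data.Fin.Subset using (Subset; _∈_; _∩_; ∣_∣; inside; outside)
open import Data.Fin.Subset.Properties using (_∈?_; nonempty?; Empty-unique; ∣⊥∣≡0; x∈p∩q⁺; x∈p∩q⁻; x∈p∪q⁺; x∈p∪q⁻; ∉⊥; x∈p∧x≢y⇒x∈p-y; x∈p⇒∣p-x∣<∣p∣)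
open import Data.Integer.Base as ℤ using (ℤ) renaming (+_ to pos)
import Data.Integer.Properties as ℤ
import Data.Integer.Tactic.RingSolver as ℤSolver
open import Data.List.Base as List using ([]; _∷_; filter)
open import Data.Nat.Base using (ℕ; zero; suc; _+_; _*_; _≤_; _<_; _∸_; z≤n; s≤s; s≤s⁻¹; z<s; >-nonZero)
open import Data.Nat.DivMod using (_%_; _/_; m≡m%n+[m/n]*n; m%n<n)
open import Data.Nat.ListAction using (sum)
open import Data.Nat.Induction using (<-rec)
open import Data.Nat.Properties
import Data.Nat.Tactic.RingSolver as ℕSolver
open import Data.Product.Base using (∃; _×_; _,_; proj₁; proj₂)
open import Data.Sum.Base using (_⊎_; inj₁; inj₂)
open import Data.Vec.Base using ([]; _∷_)
open import Data.Vec.Properties using (lookup∘tabulate; []=⇒lookup; lookup⇒[]=)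
open import Function.Base using (_∘_; id)
open import Function.Bundles using (Bijection)
open import Level using (0ℓ)
open import Relation.Binary.PropositionalEquality
open import Relation.Nullary.Decidable using (Dec; yes; no; does)
open import Relation.Nullary.Negation using (¬_; contradiction)
open import Relation.Unary using (Pred; Decidable)

open Algebra.Properties.Semiring.Sum +-*-semiring
  using (sum-syntax; sum-cong-≗; sum-replicate-zero; ∑-distrib-+; ∑-comm; *-distribˡ-sum; *-distribʳ-sum)
  renaming (sum to ∑)

𝟙 : ∀ {a} {P : Set a} → Dec P → ℕ
𝟙 P? = if does P? then 1 else 0

𝟙-true : ∀ {a} {P : Set a} (P? : Dec P) → P → 𝟙 P? ≡ 1
𝟙-true (yes _) _ = refl
𝟙-true (no ¬p) p = contradiction p ¬p

𝟙-false : ∀ {a} {P : Set a} (P? : Dec P) → ¬ P → 𝟙 P? ≡ 0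
𝟙-false (yes p) ¬p = contradiction p ¬p
𝟙-false (no _)  _  = refl

𝟙-*-positive : ∀ {a b} {P : Set a} {Q : Set b} (P? : Dec P) (Q? : Dec Q) → 0 < 𝟙 P? * 𝟙 Q? → P × Q
𝟙-*-positive (yes p) (yes q) _ = p , q

-- The motive `Φ` is explicit, so that one case distinction rewrites all chosen occurrences of the
-- indicator.
𝟙-elim : ∀ {a ℓ} {P : Set a} (P? : Dec P) (Φ : ℕ → Set ℓ) → (P → Φ 1) → (¬ P → Φ 0) → Φ (𝟙 P?)
𝟙-elim (yes p) Φ f g = f p
𝟙-elim (no ¬p) Φ f g = g ¬p

𝟙-cong : ∀ {a b} {P : Set a} {Q : Set b} (P? : Dec P) (Q? : Dec Q) →
         (P → Q) → (Q → P) → 𝟙 P? ≡ 𝟙 Q?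
𝟙-cong (yes p) Q? f g = sym (𝟙-true Q? (f p))
𝟙-cong (no ¬p) Q? f g = sym (𝟙-false Q? (¬p ∘ g))

∑-indicator : ∀ {n} (a : Fin n) (f : Fin n → ℕ) → ∑[ y < n ] (𝟙 (a Fin.≟ y) * f y) ≡ f a
∑-indicator {suc n} Fin.zero    f =
  trans (cong₂ _+_ (*-identityˡ (f Fin.zero)) (sum-replicate-zero n)) (+-identityʳ _)
∑-indicator {suc n} (Fin.suc a) f = ∑-indicator a (f ∘ Fin.suc)

∑-positive⇒term-positive : ∀ {n} (t : Fin n → ℕ) → 0 < ∑ t → ∃ λ i → 0 < t i
∑-positive⇒term-positive {suc n} t 0<∑ with t Fin.zero in eq
... | suc m = Fin.zero , subst (0 <_) (sym eq) z<s
... | zero  with ∑-positive⇒term-positive (t ∘ Fin.suc) 0<∑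
...   | i , 0<tᵢ = Fin.suc i , 0<tᵢ

term≤∑ : ∀ {n} (t : Fin n → ℕ) i → t i ≤ ∑ t
term≤∑ t Fin.zero    = m≤m+n _ _
term≤∑ t (Fin.suc i) = ≤-trans (term≤∑ (t ∘ Fin.suc) i) (m≤n+m _ _)

-- Stated for arbitrary `g` because the induction passes to `g ∘ Fin.suc`; `allFin` is the case
-- `g = id`.
sum-filter-tabulate : ∀ {m n} {P : Pred (Fin n) 0ℓ} (P? : Decidable P) (f : Fin n → ℕ) (g : Fin m → Fin n) →
  sum (List.map f (filter P? (List.tabulate g))) ≡ ∑[ i < m ] (𝟙 (P? (g i)) * f (g i))
sum-filter-tabulate {zero}  P? f g = refl
sum-filter-tabulate {suc m} P? f g with P? (g Fin.zero)
... | yes _ = cong₂ _+_ (sym (*-identityˡ _)) (sum-filter-tabulate P? f (g ∘ Fin.suc))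
... | no  _ = sum-filter-tabulate P? f (g ∘ Fin.suc)

sumOver-∑ : ∀ {n} (S : Subset n) f → sumOver S f ≡ ∑[ y < n ] (𝟙 (y ∈? S) * f y)
sumOver-∑ S f = sum-filter-tabulate (_∈? S) f id

∣S∣-∑ : ∀ {n} (S : Subset n) → ∣ S ∣ ≡ ∑[ y < n ] 𝟙 (y ∈? S)
∣S∣-∑ []            = refl
∣S∣-∑ (inside  ∷ S) = cong suc (∣S∣-∑ S)
∣S∣-∑ (outside ∷ S) = ∣S∣-∑ S

∣S∣≡1⇒nonempty : ∀ {n} (S : Subset n) → ∣ S ∣ ≡ 1 → ∃ λ x → x ∈ S
∣S∣≡1⇒nonempty {n} S ∣S∣≡1 with nonempty? S
... | yes ne = ne
... | no  em = contradiction (trans (sym (∣⊥∣≡0 n)) (trans (cong ∣_∣ (sym (Empty-unique em))) ∣S∣≡1)) λ ()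

-- If `x` and `y` differed, deleting `y` and then `x` would strictly lower the cardinality twice,
-- starting from 1.
∣S∣≡1⇒unique : ∀ {n} {S : Subset n} {x y} → ∣ S ∣ ≡ 1 → x ∈ S → y ∈ S → x ≡ y
∣S∣≡1⇒unique {S = S} {x} {y} ∣S∣≡1 x∈S y∈S with x Fin.≟ y
... | yes x≡y = x≡y
... | no  x≢y = contradiction
  (≤-trans (s≤s (≤-trans (s≤s z≤n) (x∈p⇒∣p-x∣<∣p∣ (x∈p∧x≢y⇒x∈p-y x∈S x≢y)))) (≤-trans (x∈p⇒∣p-x∣<∣p∣ y∈S) (≤-reflexive ∣S∣≡1)))
  (<-irrefl refl)

module _ {n} {P : Pred (Fin n) 0ℓ} (P? : Decidable P) where

  ∈-subset⁻ : ∀ {y} → y ∈ subset P? → P y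
  ∈-subset⁻ {y} y∈ with P? y | trans (sym (lookup∘tabulate (does ∘ P?) y)) ([]=⇒lookup y∈)
  ... | yes p | _ = p
  ... | no  _ | ()

  ∈-subset⁺ : ∀ {y} → P y → y ∈ subset P?
  ∈-subset⁺ {y} p = lookup⇒[]= y _ (trans (lookup∘tabulate (does ∘ P?) y) (does-true (P? y)))
    where
    does-true : (d : Dec (P y)) → does d ≡ true
    does-true (yes _) = refl
    does-true (no ¬p) = contradiction p ¬p

-- Least witnesses and neighbouring distances.

least : ∀ {P : Pred ℕ 0ℓ} → Decidable P → ∀ k → P k → ∃ λ m → P m × (∀ {i} → i < m → ¬ P i)
least {P} P? = <-rec _ go where
  go : ∀ k → (∀ {i} → i < k → P i → ∃ λ m → P m × (∀ {i} → i < m → ¬ P i)) →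
       P k → ∃ λ m → P m × (∀ {i} → i < m → ¬ P i)
  go k rec pk with anyUpTo? P? k
  ... | yes (i , i<k , pi) = rec i<k pi
  ... | no  ∄              = k , pk , λ i<k pi → ∄ (_ , i<k , pi)

-- `below` is phrased with `suc m`, so it is vacuous at `i = 0` and avoids truncated subtraction.
data Near (i m : ℕ) : Set where
  above : m ≡ suc i → Near i m
  level : m ≡ i → Near i m
  below : suc m ≡ i → Near i m

near : ∀ {i m} → m ≤ suc i → i ≤ suc m → Near i m
near {i} {m} m≤1+i i≤1+m with m≤n⇒m<n∨m≡n m≤1+i
... | inj₂ eq = above eq
... | inj₁ (s≤s m≤i) with m≤n⇒m<n∨m≡n m≤i
...   | inj₂ eq  = level eq
...   | inj₁ m<i = below (≤-antisym m<i i≤1+m)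

-- The three cases exclude each other, so exactly one indicator is 1. Summed over the neighbours of
-- a vertex, this splits the degree.
near-∑-suc : ∀ {i m} → Near (suc i) m → 𝟙 (m ≟ suc (suc i)) + 𝟙 (m ≟ suc i) + 𝟙 (m ≟ i) ≡ 1
near-∑-suc {i} (above refl)
  rewrite 𝟙-true (i ≟ i) refl | 𝟙-false (suc i ≟ i) 1+n≢n
        | 𝟙-false (suc (suc i) ≟ i) (λ eq → m≢1+n+m i (sym eq)) = refl
near-∑-suc {i} (level refl)
  rewrite 𝟙-false (i ≟ suc i) (1+n≢n ∘ sym) | 𝟙-true (i ≟ i) refl | 𝟙-false (suc i ≟ i) 1+n≢n = refl
near-∑-suc {i} (below refl)
  rewrite 𝟙-false (i ≟ suc (suc i)) (m≢1+n+m i) | 𝟙-false (i ≟ suc i) (1+n≢n ∘ sym) | 𝟙-true (i ≟ i) refl = refl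

near-∑-zero : ∀ {m} → Near 0 m → 𝟙 (m ≟ 1) + 𝟙 (m ≟ 0) ≡ 1
near-∑-zero (above refl) = refl
near-∑-zero (level refl) = refl

-- Walks and two-colourings.

module _ {n} {G : Graph n} where
  open Graph G using (Adj)

  infixr 5 _⟫_
  _⟫_ : ∀ {k m x y z} → Walk G k x y → Walk G m y z → Walk G (k + m) x z
  nil      ⟫ w = w
  cons a v ⟫ w = cons a (v ⟫ w)

  reverse : ∀ {k x y} → Walk G k x y → Walk G k y x
  reverse nil                            = nil
  reverse (cons {k = k} {x} {z = z} a w) = subst (λ m → Walk G m z x) (+-comm k 1) (reverse w ⟫ cons (Graph.sym G a) nil)

  module _ (colour : Fin n → Bool) (proper : ∀ {x y} → Adj x y → colour x ≢ colour y) where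

    -- Each edge negates the colour, so the final colour depends only on the initial one and on the
    -- length.
    colour-endpoints : ∀ {k x x′ y y′} → colour x ≡ colour x′ → Walk G k x y → Walk G k x′ y′ → colour y ≡ colour y′
    colour-endpoints eq nil        nil          = eq
    colour-endpoints eq (cons a v) (cons a′ v′) = colour-endpoints
      (trans (¬-not (proper a ∘ sym)) (trans (cong not eq) (sym (¬-not (proper a′ ∘ sym))))) v v′

-- The graph metric.

module Metric {n} (G : Graph n) (connected : Connected G) where
  open Graph G using (Adj)

  abstract
    δ-spec : ∀ x y → ∃ λ k → Distance G k x y
    δ-spec x y = let k , w = connected x y in least (λ k → walk? G k x y) k w

  δ : Fin n → Fin n → ℕ
  δ x y = proj₁ (δ-spec x y)

  δ-distance : ∀ x y → Distance G (δ x y) x y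
  δ-distance x y = proj₂ (δ-spec x y)

  δ-walk : ∀ x y → Walk G (δ x y) x y
  δ-walk x y = proj₁ (δ-distance x y)

  walk⇒δ≤ : ∀ {k x y} → Walk G k x y → δ x y ≤ k
  walk⇒δ≤ {x = x} {y} w = ≮⇒≥ λ k<δ → proj₂ (δ-distance x y) k<δ w

  distance⇒δ≡ : ∀ {k x y} → Distance G k x y → δ x y ≡ k
  distance⇒δ≡ {x = x} {y} (w , min) = ≤-antisym (walk⇒δ≤ w) (≮⇒≥ λ δ<k → min δ<k (δ-walk x y))

  δ≡⇒distance : ∀ {k x y} → δ x y ≡ k → Distance G k x y
  δ≡⇒distance refl = δ-distance _ _

  δ-sym : ∀ x y → δ x y ≡ δ y x
  δ-sym x y = ≤-antisym (walk⇒δ≤ (reverse (δ-walk y x))) (walk⇒δ≤ (reverse (δ-walk x y)))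

  δ-triangle : ∀ x y z → δ x z ≤ δ x y + δ y z
  δ-triangle x y z = walk⇒δ≤ (δ-walk x y ⟫ δ-walk y z)

  δ-refl : ∀ x → δ x x ≡ 0
  δ-refl x = n≤0⇒n≡0 (walk⇒δ≤ nil)

  δ≡0⇒≡ : ∀ {x y} → δ x y ≡ 0 → x ≡ y
  δ≡0⇒≡ eq with proj₁ (δ≡⇒distance eq)
  ... | nil = refl

  adj⇒δ≡1 : ∀ {x y} → Adj x y → δ x y ≡ 1
  adj⇒δ≡1 {x} {y} a with δ x y in eq | walk⇒δ≤ (cons a nil)
  ... | zero  | _       = contradiction a (Graph.irrefl G (δ≡0⇒≡ eq))
  ... | suc _ | s≤s z≤n = refl

  δ≡1⇒adj : ∀ {x y} → δ x y ≡ 1 → Adj x y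
  δ≡1⇒adj eq with proj₁ (δ≡⇒distance eq)
  ... | cons a nil = a

  -- By the triangle inequality, each of `δ x y` and `δ x z` exceeds the other by at most one.
  δ-near : ∀ {i} x {y z} → δ x y ≡ i → δ y z ≡ 1 → Near i (δ x z)
  δ-near x {y} {z} refl δyz≡1 = near (step δyz≡1) (step (trans (δ-sym z y) δyz≡1))
    where
    step : ∀ {y z} → δ y z ≡ 1 → δ x z ≤ suc (δ x y)
    step {y} {z} eq = ≤-trans (δ-triangle x y z) (≤-reflexive (trans (cong (δ x y +_) eq) (+-comm _ 1)))

  -- Distances from x change by at most one along a walk, so no value is skipped.
  crossing : ∀ {k i x y z} → Walk G k y z → δ x y ≤ i → i < δ x z →
             ∃ λ u → ∃ λ w → δ u w ≡ 1 × δ x u ≡ i × δ x w ≡ suc i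
  crossing nil δxy≤i i<δxz = contradiction (≤-trans i<δxz δxy≤i) (<-irrefl refl)
  crossing {i = i} {x} {y} (cons {y = y′} a v) δxy≤i i<δxz with δ x y′ ≤? i
  ... | yes δxy′≤i = crossing v δxy′≤i i<δxz
  ... | no  δxy′≰i = y , y′ , adj⇒δ≡1 a , δxy≡i , ≤-antisym (≤-trans δxy′≤1+δxy (s≤s δxy≤i)) i<δxy′
    where
    i<δxy′ : i < δ x y′
    i<δxy′ = ≰⇒> δxy′≰i
    δxy′≤1+δxy : δ x y′ ≤ suc (δ x y)
    δxy′≤1+δxy = ≤-trans (δ-triangle x y y′) (≤-reflexive (trans (cong (δ x y +_) (adj⇒δ≡1 a)) (+-comm _ 1)))
    δxy≡i : δ x y ≡ i
    δxy≡i = ≤-antisym δxy≤i (s≤s⁻¹ (≤-trans i<δxy′ δxy′≤1+δxy))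

  -- Spheres, sphere sums and neighbour counts.

  ∈sphere⁻ : ∀ {j x y} → y ∈ sphere G j x → δ x y ≡ j
  ∈sphere⁻ {j} {x} y∈ = distance⇒δ≡ (∈-subset⁻ (distance? G j x) y∈)

  ∈sphere⁺ : ∀ {j x y} → δ x y ≡ j → y ∈ sphere G j x
  ∈sphere⁺ {j} {x} eq = ∈-subset⁺ (distance? G j x) (δ≡⇒distance eq)

  -- This is the distance matrix `A_j` applied to the vector `f`.
  sphereSum : ℕ → (Fin n → ℕ) → Fin n → ℕ
  sphereSum j f x = ∑[ y < n ] (𝟙 (δ x y ≟ j) * f y)

  sphereSum-zero : ∀ f x → sphereSum 0 f x ≡ f x
  sphereSum-zero f x = trans
    (sum-cong-≗ λ y → cong (_* f y) (𝟙-cong (δ x y ≟ 0) (x Fin.≟ y) δ≡0⇒≡ λ { refl → δ-refl x }))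
    (∑-indicator x f)

  neighbourhood-sum₁ : ∀ j f x → sumOver (neighbourhood G (j ∷ []) x) f ≡ sphereSum j f x
  neighbourhood-sum₁ j f x = trans (sumOver-∑ _ f) (sum-cong-≗ λ y →
    cong (_* f y) (𝟙-cong (y ∈? _) (δ x y ≟ j) (to y) (x∈p∪q⁺ ∘ inj₁ ∘ ∈sphere⁺)))
    where
    to : ∀ y → y ∈ neighbourhood G (j ∷ []) x → δ x y ≡ j
    to y y∈ with x∈p∪q⁻ (sphere G j x) _ y∈
    ... | inj₁ y∈S = ∈sphere⁻ y∈S
    ... | inj₂ y∈⊥ = contradiction y∈⊥ ∉⊥

  ∈neighbourhood₂⁻ : ∀ i j x {y} → y ∈ neighbourhood G (i ∷ j ∷ []) x → δ x y ≡ i ⊎ δ x y ≡ j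
  ∈neighbourhood₂⁻ i j x y∈ with x∈p∪q⁻ (sphere G i x) _ y∈
  ... | inj₁ y∈Sᵢ = inj₁ (∈sphere⁻ y∈Sᵢ)
  ... | inj₂ y∈′ with x∈p∪q⁻ (sphere G j x) _ y∈′
  ...   | inj₁ y∈Sⱼ = inj₂ (∈sphere⁻ y∈Sⱼ)
  ...   | inj₂ y∈⊥  = contradiction y∈⊥ ∉⊥

  ∈neighbourhood₂⁺ : ∀ i j x {y} → δ x y ≡ i ⊎ δ x y ≡ j → y ∈ neighbourhood G (i ∷ j ∷ []) x
  ∈neighbourhood₂⁺ i j x (inj₁ eq) = x∈p∪q⁺ (inj₁ (∈sphere⁺ eq))
  ∈neighbourhood₂⁺ i j x (inj₂ eq) = x∈p∪q⁺ {p = sphere G i x} (inj₂ (x∈p∪q⁺ (inj₁ (∈sphere⁺ eq))))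

  -- A union counts a repeated sphere only once, so the sum is not doubled. This serves the case
  -- `j ≡ d ∸ j`.
  neighbourhood-sum₂-≡ : ∀ j f x → sumOver (neighbourhood G (j ∷ j ∷ []) x) f ≡ sphereSum j f x
  neighbourhood-sum₂-≡ j f x = trans (sumOver-∑ _ f) (sum-cong-≗ λ y →
    cong (_* f y) (𝟙-cong (y ∈? _) (δ x y ≟ j)
      (λ y∈ → case (∈neighbourhood₂⁻ j j x y∈)) (∈neighbourhood₂⁺ j j x ∘ inj₁)))
    where
    case : ∀ {y} → δ x y ≡ j ⊎ δ x y ≡ j → δ x y ≡ j
    case (inj₁ eq) = eq
    case (inj₂ eq) = eq

  -- Spheres of different radii about `x` are disjoint, so the indicator of their union is the sum
  -- of the two indicators.
  neighbourhood-sum₂-≢ : ∀ {i j} → i ≢ j → ∀ f x →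
    sumOver (neighbourhood G (i ∷ j ∷ []) x) f ≡ sphereSum i f x + sphereSum j f x
  neighbourhood-sum₂-≢ {i} {j} i≢j f x = trans (sumOver-∑ _ f) (trans
    (sum-cong-≗ λ y → trans (cong (_* f y) (pointwise y)) (*-distribʳ-+ (f y) (𝟙 (δ x y ≟ i)) _))
    (∑-distrib-+ (λ y → 𝟙 (δ x y ≟ i) * f y) (λ y → 𝟙 (δ x y ≟ j) * f y)))
    where
    pointwise : ∀ y → 𝟙 (y ∈? neighbourhood G (i ∷ j ∷ []) x) ≡ 𝟙 (δ x y ≟ i) + 𝟙 (δ x y ≟ j)
    pointwise y with y ∈? neighbourhood G (i ∷ j ∷ []) x
    ... | no y∉ = sym (cong₂ _+_ (𝟙-false (δ x y ≟ i) (y∉ ∘ ∈neighbourhood₂⁺ i j x ∘ inj₁))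
                                 (𝟙-false (δ x y ≟ j) (y∉ ∘ ∈neighbourhood₂⁺ i j x ∘ inj₂)))
    ... | yes y∈ with ∈neighbourhood₂⁻ i j x y∈
    ...   | inj₁ eq = sym (cong₂ _+_ (𝟙-true (δ x y ≟ i) eq) (𝟙-false (δ x y ≟ j) (i≢j ∘ trans (sym eq))))
    ...   | inj₂ eq = sym (cong₂ _+_ (𝟙-false (δ x y ≟ i) (λ eq′ → i≢j (trans (sym eq′) eq))) (𝟙-true (δ x y ≟ j) eq))

  -- As a matrix in `x` and `z` this is `A_j A_1`. For `δ x z ≡ i`, the radii `i + 1`, `i`, `i - 1`
  -- give the intersection numbers `b_i`, `a_i`, `c_i`.
  count : Fin n → Fin n → ℕ → ℕ
  count x z j = ∑[ y < n ] (𝟙 (δ z y ≟ 1) * 𝟙 (δ x y ≟ j))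

  ∣neighbours∩sphere∣ : ∀ x z j → ∣ neighbours G z ∩ sphere G j x ∣ ≡ count x z j
  ∣neighbours∩sphere∣ x z j = trans (∣S∣-∑ (neighbours G z ∩ sphere G j x)) (sum-cong-≗ pointwise)
    where
    pointwise : ∀ y → 𝟙 (y ∈? (neighbours G z ∩ sphere G j x)) ≡ 𝟙 (δ z y ≟ 1) * 𝟙 (δ x y ≟ j)
    pointwise y = 𝟙-elim (δ z y ≟ 1) (λ t → 𝟙 (y ∈? (neighbours G z ∩ sphere G j x)) ≡ t * 𝟙 (δ x y ≟ j))
      (λ δzy≡1 → trans
        (𝟙-cong (y ∈? _) (δ x y ≟ j) (λ y∈ → ∈sphere⁻ (proj₂ (x∈p∩q⁻ (neighbours G z) _ y∈)))
          (λ eq → x∈p∩q⁺ (∈-subset⁺ (Graph.adj? G z) (δ≡1⇒adj δzy≡1) , ∈sphere⁺ eq)))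
        (sym (*-identityˡ _)))
      (λ δzy≢1 → 𝟙-false (y ∈? _) λ y∈ →
        δzy≢1 (adj⇒δ≡1 (∈-subset⁻ (Graph.adj? G z) (proj₁ (x∈p∩q⁻ (neighbours G z) _ y∈)))))

  count-positive : ∀ {x z y j} → δ z y ≡ 1 → δ x y ≡ j → 0 < count x z j
  count-positive {x} {z} {y} {j} δzy≡1 δxy≡j = ≤-trans
    (≤-reflexive (sym (cong₂ _*_ (𝟙-true (δ z y ≟ 1) δzy≡1) (𝟙-true (δ x y ≟ j) δxy≡j))))
    (term≤∑ (λ y → 𝟙 (δ z y ≟ 1) * 𝟙 (δ x y ≟ j)) y)

  count-witness : ∀ {x z j} → 0 < count x z j → ∃ λ y → δ z y ≡ 1 × δ x y ≡ j
  count-witness {x} {z} {j} 0<count with ∑-positive⇒term-positive _ 0<count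
  ... | y , 0<t = y , 𝟙-*-positive (δ z y ≟ 1) (δ x y ≟ j) 0<t

  count-zero : ∀ {x z j} → (∀ y → δ z y ≡ 1 → δ x y ≢ j) → count x z j ≡ 0
  count-zero {x} {z} {j} h with count x z j in eq
  ... | zero  = refl
  ... | suc _ with count-witness (subst (0 <_) (sym eq) z<s)
  ...   | y , δzy≡1 , δxy≡j = contradiction δxy≡j (h y δzy≡1)

  degree : Fin n → ℕ
  degree z = ∑[ y < n ] 𝟙 (δ z y ≟ 1)

  -- Indicators are idempotent. This presents the degree as `b_0`, whence regularity of the graph.
  degree-count : ∀ z → degree z ≡ count z z 1
  degree-count z = sum-cong-≗ λ y →
    𝟙-elim (δ z y ≟ 1) (λ t → t ≡ t * t) (λ _ → refl) (λ _ → refl)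

  degree-split-zero : ∀ {x z} → δ x z ≡ 0 → degree z ≡ count x z 1 + count x z 0
  degree-split-zero {x} {z} eq = trans (sum-cong-≗ pointwise) (∑-distrib-+ (λ y → 𝟙 (δ z y ≟ 1) * 𝟙 (δ x y ≟ 1)) _)
    where
    pointwise : ∀ y → 𝟙 (δ z y ≟ 1) ≡ 𝟙 (δ z y ≟ 1) * 𝟙 (δ x y ≟ 1) + 𝟙 (δ z y ≟ 1) * 𝟙 (δ x y ≟ 0)
    pointwise y = 𝟙-elim (δ z y ≟ 1) (λ t → t ≡ t * 𝟙 (δ x y ≟ 1) + t * 𝟙 (δ x y ≟ 0))
      (λ δzy≡1 → trans (sym (near-∑-zero (δ-near x eq δzy≡1)))
        (sym (cong₂ _+_ (*-identityˡ (𝟙 (δ x y ≟ 1))) (*-identityˡ (𝟙 (δ x y ≟ 0))))))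
      (λ _ → refl)

  -- The identity `k = b + a + c`: every neighbour of `z` lies in one of three consecutive spheres
  -- about `x`.
  degree-split-suc : ∀ {i x z} → δ x z ≡ suc i →
    degree z ≡ count x z (suc (suc i)) + count x z (suc i) + count x z i
  degree-split-suc {i} {x} {z} eq = trans (sum-cong-≗ pointwise)
    (trans (∑-distrib-+ (λ y → t y (suc (suc i)) + t y (suc i)) _)
           (cong (_+ count x z i) (∑-distrib-+ (λ y → t y (suc (suc i))) _)))
    where
    t : Fin n → ℕ → ℕ
    t y j = 𝟙 (δ z y ≟ 1) * 𝟙 (δ x y ≟ j)
    pointwise : ∀ y → 𝟙 (δ z y ≟ 1) ≡ t y (suc (suc i)) + t y (suc i) + t y i
    pointwise y = 𝟙-elim (δ z y ≟ 1)
      (λ s → s ≡ s * 𝟙 (δ x y ≟ suc (suc i)) + s * 𝟙 (δ x y ≟ suc i) + s * 𝟙 (δ x y ≟ i))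
      (λ δzy≡1 → trans (sym (near-∑-suc (δ-near x eq δzy≡1)))
        (sym (cong₂ _+_ (cong₂ _+_ (*-identityˡ (𝟙 (δ x y ≟ suc (suc i)))) (*-identityˡ (𝟙 (δ x y ≟ suc i))))
                        (*-identityˡ (𝟙 (δ x y ≟ i))))))
      (λ _ → refl)

  -- Associativity `A_j (A f) = (A_j A) f`, obtained by exchanging the two sums and using the
  -- symmetry of `δ`.
  sphereSum-adjacency : ∀ j f x → sphereSum j (sphereSum 1 f) x ≡ ∑[ z < n ] (count x z j * f z)
  sphereSum-adjacency j f x = begin
    ∑[ y < n ] (𝟙 (δ x y ≟ j) * ∑[ z < n ] (𝟙 (δ y z ≟ 1) * f z))
      ≡⟨ sum-cong-≗ (λ y → *-distribˡ-sum (𝟙 (δ x y ≟ j)) (λ z → 𝟙 (δ y z ≟ 1) * f z)) ⟩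
    ∑[ y < n ] ∑[ z < n ] (𝟙 (δ x y ≟ j) * (𝟙 (δ y z ≟ 1) * f z))
      ≡⟨ ∑-comm (λ y z → 𝟙 (δ x y ≟ j) * (𝟙 (δ y z ≟ 1) * f z)) ⟩
    ∑[ z < n ] ∑[ y < n ] (𝟙 (δ x y ≟ j) * (𝟙 (δ y z ≟ 1) * f z))
      ≡⟨ sum-cong-≗ (λ z → trans (sum-cong-≗ (λ y → rearrange y z))
           (sym (*-distribʳ-sum (f z) (λ y → 𝟙 (δ z y ≟ 1) * 𝟙 (δ x y ≟ j))))) ⟩
    ∑[ z < n ] (count x z j * f z) ∎
    where
    open ≡-Reasoning
    rearrange : ∀ y z → 𝟙 (δ x y ≟ j) * (𝟙 (δ y z ≟ 1) * f z) ≡ 𝟙 (δ z y ≟ 1) * 𝟙 (δ x y ≟ j) * f z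
    rearrange y z = trans (sym (*-assoc (𝟙 (δ x y ≟ j)) (𝟙 (δ y z ≟ 1)) (f z)))
      (cong (_* f z) (trans (*-comm (𝟙 (δ x y ≟ j)) (𝟙 (δ y z ≟ 1))) (cong (λ m → 𝟙 (m ≟ 1) * 𝟙 (δ x y ≟ j)) (δ-sym y z))))

-- Intersection numbers of a distance-regular graph.

module DistanceRegular {n} (G : Graph n) (d : ℕ) (isDR : IsDistanceRegular G d) where
  open IsDistanceRegular isDR
  open Metric G connected public

  δ≤d : ∀ x y → δ x y ≤ d
  δ≤d x y = proj₂ diameter x y _ (δ-distance x y)

  -- The parameters `b` and `c` are indexed by `Fin (suc d)`; the diameter bound turns any realised
  -- distance into such an index.
  index : ∀ {i x y} → δ x y ≡ i → ∃ λ (k : Fin (suc d)) → toℕ k ≡ i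
  index {x = x} {y} refl = fromℕ< (s≤s (δ≤d x y)) , Fin.toℕ-fromℕ< (s≤s (δ≤d x y))

  count-above : ∀ {i x z x′ z′} → δ x z ≡ i → δ x′ z′ ≡ i → count x z (suc i) ≡ count x′ z′ (suc i)
  count-above {x = x} {z} {x′} {z′} eq eq′ with index eq
  ... | k , refl = trans (value eq) (sym (value eq′))
    where
    value : ∀ {x z} → δ x z ≡ toℕ k → count x z (suc (toℕ k)) ≡ b k
    value {x} {z} eq = trans (sym (∣neighbours∩sphere∣ x z _)) (b-count k x z (δ≡⇒distance eq))

  count-below : ∀ {i x z x′ z′} → δ x z ≡ suc i → δ x′ z′ ≡ suc i → count x z i ≡ count x′ z′ i
  count-below {i} eq eq′ with index eq
  ... | k , toℕk≡1+i = trans (value eq) (sym (value eq′))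
    where
    value : ∀ {x z} → δ x z ≡ suc i → count x z i ≡ c k
    value {x} {z} eq = trans (sym (∣neighbours∩sphere∣ x z _))
      -- Once the index is visibly `suc i`, `spherePred` reduces to the sphere of radius `i`.
      (subst (λ m → ∣ neighbours G z ∩ spherePred G m x ∣ ≡ c k) toℕk≡1+i
        (c-count k x z (δ≡⇒distance (trans eq (sym toℕk≡1+i)))))

  degree-constant : ∀ z z′ → degree z ≡ degree z′
  degree-constant z z′ =
    trans (degree-count z) (trans (count-above (δ-refl z) (δ-refl z′)) (sym (degree-count z′)))

  -- Only `b` and `c` are prescribed; `a_i` is what remains of the constant degree when both are
  -- cancelled.
  count-level : ∀ {i x z x′ z′} → δ x z ≡ i → δ x′ z′ ≡ i → count x z i ≡ count x′ z′ i
  count-level {zero} {x} {z} {x′} {z′} eq eq′ = +-cancelˡ-≡ (count x z 1) _ _ (begin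
    count x z 1 + count x z 0     ≡⟨ degree-split-zero eq ⟨
    degree z                      ≡⟨ degree-constant z z′ ⟩
    degree z′                     ≡⟨ degree-split-zero eq′ ⟩
    count x′ z′ 1 + count x′ z′ 0 ≡⟨ cong (_+ _) (count-above eq eq′) ⟨
    count x z 1 + count x′ z′ 0   ∎)
    where open ≡-Reasoning
  count-level {suc i} {x} {z} {x′} {z′} eq eq′ =
    +-cancelˡ-≡ (count x z (suc (suc i))) _ _ (+-cancelʳ-≡ (count x z i) _ _ (begin
    count x z (suc (suc i)) + count x z (suc i) + count x z i       ≡⟨ degree-split-suc eq ⟨
    degree z                                                        ≡⟨ degree-constant z z′ ⟩
    degree z′                                                       ≡⟨ degree-split-suc eq′ ⟩
    count x′ z′ (suc (suc i)) + count x′ z′ (suc i) + count x′ z′ i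
      ≡⟨ cong₂ (λ s t → s + count x′ z′ (suc i) + t) (count-above eq eq′) (count-below eq eq′) ⟨
    count x z (suc (suc i)) + count x′ z′ (suc i) + count x z i     ∎))
    where open ≡-Reasoning

  count-far : ∀ {i j x z} → δ x z ≡ i → j ≢ suc i → j ≢ i → suc j ≢ i → count x z j ≡ 0
  count-far {x = x} eq j≢1+i j≢i 1+j≢i = count-zero λ { y δzy≡1 refl → case (δ-near x eq δzy≡1) }
    where
    case : ¬ Near _ _
    case (above p) = j≢1+i p
    case (level p) = j≢i p
    case (below p) = 1+j≢i p

  -- This allows the coefficients of `A_j A` to be read off at any one pair of vertices for each
  -- distance.
  count-constant : ∀ {x z x′ z′} j → δ x z ≡ δ x′ z′ → count x z j ≡ count x′ z′ j
  count-constant {x} {z} {x′} {z′} j eq with j ≟ suc (δ x z) | j ≟ δ x z | suc j ≟ δ x z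
  ... | yes refl | _        | _     = count-above refl (sym eq)
  ... | no _     | yes refl | _     = count-level refl (sym eq)
  ... | no _     | no _     | yes p = count-below (sym p) (trans (sym eq) (sym p))
  ... | no p     | no q     | no r  = trans (count-far refl p q r) (sym (count-far (sym eq) p q r))

-- Antipodes and complementary spheres.

module AntipodalDoubleCover {n} (G : Graph n) (d : ℕ) (isDR : IsDistanceRegular G d)
                            (isADC : IsAntipodalDoubleCover G d) where
  open DistanceRegular G d isDR public

  σ : Fin n → Fin n
  σ x = proj₁ (∣S∣≡1⇒nonempty (sphere G d x) (isADC x))

  δ-σ : ∀ x → δ x (σ x) ≡ d
  δ-σ x = ∈sphere⁻ (proj₂ (∣S∣≡1⇒nonempty (sphere G d x) (isADC x)))

  δ≡d⇒σ : ∀ {x y} → δ x y ≡ d → σ x ≡ y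
  δ≡d⇒σ {x} eq = ∣S∣≡1⇒unique (isADC x) (∈sphere⁺ (δ-σ x)) (∈sphere⁺ eq)

  σ-involutive : ∀ x → σ (σ x) ≡ x
  σ-involutive x = δ≡d⇒σ (trans (δ-sym (σ x) x) (δ-σ x))

  -- A walk from `x` to `σ x` starts at distance 0 and ends at distance `d`, so some edge of it
  -- crosses from layer `i` to layer `i + 1`.
  layers : ∀ x {i} → i < d → ∃ λ u → ∃ λ w → δ u w ≡ 1 × δ x u ≡ i × δ x w ≡ suc i
  layers x i<d = crossing (δ-walk x (σ x)) (≤-trans (≤-reflexive (δ-refl x)) z≤n)
    (≤-trans i<d (≤-reflexive (sym (δ-σ x))))

  -- Every geodesic from x extends to one of length d, which must end at σ x.
  δ-σ-≤ : ∀ t {x y} → δ x y + t ≡ d → δ y (σ x) ≤ t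
  δ-σ-≤ zero    {x} {y} eq = ≤-reflexive
    (trans (cong (δ y) (δ≡d⇒σ (trans (sym (+-identityʳ _)) eq))) (δ-refl y))
  δ-σ-≤ (suc t) {x} {y} eq
    with layers x {δ x y} (≤-trans (m<m+n (δ x y) z<s) (≤-reflexive eq))
  ... | u , w , δuw≡1 , δxu≡δxy , δxw≡
    -- The edge `u w` makes the outward count positive at `u`; regularity carries this to `y`, which
    -- thus has a neighbour one step further from `x`.
    with count-witness (subst (0 <_) (count-constant (suc (δ x y)) δxu≡δxy) (count-positive {x} {u} δuw≡1 δxw≡))
  ... | y′ , δyy′≡1 , δxy′≡ = ≤-trans (δ-triangle y y′ (σ x))
    (+-mono-≤ (≤-reflexive δyy′≡1)
      (δ-σ-≤ t (trans (cong (_+ t) δxy′≡) (trans (sym (+-suc (δ x y) t)) eq))))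

  -- The upper bound is `δ-σ-≤` with `t = d ∸ δ x y`; the lower bound is the triangle inequality
  -- through `y`.
  δ+δσ≡d : ∀ x y → δ x y + δ (σ x) y ≡ d
  δ+δσ≡d x y = trans (cong (δ x y +_) (δ-sym (σ x) y)) (≤-antisym
    (≤-trans (+-monoʳ-≤ (δ x y) (δ-σ-≤ (d ∸ δ x y) (m+[n∸m]≡n (δ≤d x y)))) (≤-reflexive (m+[n∸m]≡n (δ≤d x y))))
    (≤-trans (≤-reflexive (sym (δ-σ x))) (δ-triangle x y (σ x))))

  sphereSum-diameter : ∀ f x → sphereSum d f x ≡ f (σ x)
  sphereSum-diameter f x = trans
    (sum-cong-≗ λ y → cong (_* f y) (𝟙-cong (δ x y ≟ d) (σ x Fin.≟ y) δ≡d⇒σ λ { refl → δ-σ x }))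
    (∑-indicator (σ x) f)

  -- Since distances to `x` and `σ x` add up to `d`, the sphere of radius `d ∸ j` about `x` is the
  -- sphere of radius `j` about `σ x`.
  sphereSum-complement : ∀ {j} → j ≤ d → ∀ f x → sphereSum (d ∸ j) f x ≡ sphereSum j f (σ x)
  sphereSum-complement {j} j≤d f x = sum-cong-≗ λ y → cong (_* f y) (𝟙-cong (δ x y ≟ d ∸ j) (δ (σ x) y ≟ j)
    (λ eq → +-cancelˡ-≡ (d ∸ j) _ _ (trans (cong (_+ δ (σ x) y) (sym eq)) (trans (δ+δσ≡d x y) (sym (m∸n+n≡m j≤d)))))
    (λ eq → +-cancelʳ-≡ j _ _ (trans (cong (δ x y +_) (sym eq)) (trans (δ+δσ≡d x y) (sym (m∸n+n≡m j≤d))))))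

  -- The three-term recurrence for distance matrices.

  basepoint : Fin n
  basepoint = proj₁ (proj₁ (IsDistanceRegular.diameter isDR))

  -- A A_{j+1} = c_{j+2} A_{j+2} + a_{j+1} A_{j+1} + b_j A_j, with α = c_{j+2}, β = a_{j+1}, γ = b_j.
  record ThreeTerm (j : ℕ) : Set where
    field
      α β γ      : ℕ
      α-positive : 0 < α
      β-count    : ∃ λ u → δ basepoint u ≡ suc j × count basepoint u (suc j) ≡ β
      recurrence : ∀ f x → sphereSum (suc j) (sphereSum 1 f) x ≡
                   α * sphereSum (suc (suc j)) f x + β * sphereSum (suc j) f x + γ * sphereSum j f x

  -- The vertices `u₀`, `u`, `w` lie at distances `j`, `j + 1`, `j + 2` from `basepoint`, and the
  -- coefficients are the counts there. The neighbour `u` of `w` makes `α` positive.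
  threeTerm : ∀ {j} → suc (suc j) ≤ d → ThreeTerm j
  threeTerm {j} 2+j≤d with layers basepoint {j} (≤-trans (n≤1+n _) 2+j≤d) | layers basepoint {suc j} 2+j≤d
  ... | u₀ , _ , _ , δu₀ , _ | u , w , δuw , δu , δw = record
    { α = α ; β = β ; γ = γ
    ; α-positive = count-positive (trans (δ-sym w u) δuw) δu
    ; β-count = u , δu , refl
    ; recurrence = λ f x → begin
        sphereSum (suc j) (sphereSum 1 f) x
          ≡⟨ sphereSum-adjacency (suc j) f x ⟩
        ∑[ z < n ] (count x z (suc j) * f z)
          ≡⟨ sum-cong-≗ (λ z → trans (cong (_* f z) (count-expand x z)) (distribute (f z) _ _ _)) ⟩
        ∑[ z < n ] (α * (e x z (suc (suc j)) * f z) + β * (e x z (suc j) * f z) + γ * (e x z j * f z))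
          ≡⟨ ∑-distrib-+ (λ z → α * (e x z (suc (suc j)) * f z) + β * (e x z (suc j) * f z)) _ ⟩
        ∑[ z < n ] (α * (e x z (suc (suc j)) * f z) + β * (e x z (suc j) * f z)) + ∑[ z < n ] (γ * (e x z j * f z))
          ≡⟨ cong₂ _+_
               (trans (∑-distrib-+ (λ z → α * (e x z (suc (suc j)) * f z)) _)
                 (cong₂ _+_ (sym (*-distribˡ-sum α (λ z → e x z (suc (suc j)) * f z)))
                            (sym (*-distribˡ-sum β (λ z → e x z (suc j) * f z)))))
               (sym (*-distribˡ-sum γ (λ z → e x z j * f z))) ⟩
        α * sphereSum (suc (suc j)) f x + β * sphereSum (suc j) f x + γ * sphereSum j f x ∎
    }
    where
    open ≡-Reasoning
    α β γ : ℕ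
    α = count basepoint w  (suc j)
    β = count basepoint u  (suc j)
    γ = count basepoint u₀ (suc j)
    e : Fin n → Fin n → ℕ → ℕ
    e x z i = 𝟙 (δ x z ≟ i)
    distribute : ∀ t p q r → (α * p + β * q + γ * r) * t ≡ α * (p * t) + β * (q * t) + γ * (r * t)
    distribute t p q r = trans (*-distribʳ-+ t (α * p + β * q) (γ * r)) (cong₂ _+_
      (trans (*-distribʳ-+ t (α * p) (β * q)) (cong₂ _+_ (*-assoc α p t) (*-assoc β q t))) (*-assoc γ r t))
    -- At most one of the three indicators is 1, and its coefficient is then the count; at every
    -- other distance the count vanishes by `count-far`.
    count-expand : ∀ x z → count x z (suc j) ≡ α * e x z (suc (suc j)) + β * e x z (suc j) + γ * e x z j
    count-expand x z = cases (δ x z ≟ suc (suc j)) (δ x z ≟ suc j) (δ x z ≟ j)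
      where
      weigh : ∀ {p q r} → e x z (suc (suc j)) ≡ p → e x z (suc j) ≡ q → e x z j ≡ r →
              α * e x z (suc (suc j)) + β * e x z (suc j) + γ * e x z j ≡ α * p + β * q + γ * r
      weigh p q r = cong₂ _+_ (cong₂ _+_ (cong (α *_) p) (cong (β *_) q)) (cong (γ *_) r)
      at : ∀ {i} → δ x z ≡ i → e x z i ≡ 1
      at {i} = 𝟙-true (δ x z ≟ i)
      off : ∀ {i} → δ x z ≢ i → e x z i ≡ 0
      off {i} = 𝟙-false (δ x z ≟ i)
      first : ∀ a b c → a * 1 + b * 0 + c * 0 ≡ a
      first = ℕSolver.solve-∀
      second : ∀ a b c → a * 0 + b * 1 + c * 0 ≡ b
      second = ℕSolver.solve-∀
      third : ∀ a b c → a * 0 + b * 0 + c * 1 ≡ c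
      third = ℕSolver.solve-∀
      none : ∀ a b c → a * 0 + b * 0 + c * 0 ≡ 0
      none = ℕSolver.solve-∀
      cases : Dec (δ x z ≡ suc (suc j)) → Dec (δ x z ≡ suc j) → Dec (δ x z ≡ j) →
              count x z (suc j) ≡ α * e x z (suc (suc j)) + β * e x z (suc j) + γ * e x z j
      cases (yes p) _ _ = trans (count-constant (suc j) (trans p (sym δw))) (sym (trans
        (weigh (at p) (off λ q → 1+n≢n (trans (sym p) q)) (off λ r → m≢1+n+m j (trans (sym r) p)))
        (first α β γ)))
      cases (no p) (yes q) _ = trans (count-constant (suc j) (trans q (sym δu))) (sym (trans
        (weigh (off p) (at q) (off λ r → 1+n≢n (trans (sym q) r)))
        (second α β γ)))
      cases (no p) (no q) (yes r) = trans (count-constant (suc j) (trans r (sym δu₀))) (sym (trans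
        (weigh (off p) (off q) (at r))
        (third α β γ)))
      cases (no p) (no q) (no r) = trans
        (count-far refl (r ∘ sym ∘ suc-injective) (q ∘ sym) (p ∘ sym))
        (sym (trans (weigh (off p) (off q) (off r)) (none α β γ)))

  -- Linearity of sphere sums and constancy of sphere sizes.

  sphereSum-linear : ∀ j ε f g x →
    sphereSum j (λ y → ε * f y + g y) x ≡ ε * sphereSum j f x + sphereSum j g x
  sphereSum-linear j ε f g x = trans
    (sum-cong-≗ λ y → distribute (𝟙 (δ x y ≟ j)) ε (f y) (g y))
    (trans (∑-distrib-+ (λ y → ε * (𝟙 (δ x y ≟ j) * f y)) _)
           (cong (_+ sphereSum j g x) (sym (*-distribˡ-sum ε (λ y → 𝟙 (δ x y ≟ j) * f y)))))
    where
    distribute : ∀ e ε s t → e * (ε * s + t) ≡ ε * (e * s) + e * t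
    distribute = ℕSolver.solve-∀

  -- Written as a sphere sum so that the recurrence also governs sizes.
  sphereSize : ℕ → Fin n → ℕ
  sphereSize j = sphereSum j (λ _ → 1)

  sphereSum-constant : ∀ j {g κ} → (∀ y → g y ≡ κ) → ∀ x → sphereSum j g x ≡ sphereSize j x * κ
  sphereSum-constant j {g} {κ} g≡κ x = trans
    (sum-cong-≗ λ y → trans (cong (𝟙 (δ x y ≟ j) *_) (g≡κ y)) (cong (_* κ) (sym (*-identityʳ (𝟙 (δ x y ≟ j))))))
    (sym (*-distribʳ-sum κ (λ y → 𝟙 (δ x y ≟ j) * 1)))

  sphereSize₁-constant : ∀ x y → sphereSize 1 x ≡ sphereSize 1 y
  sphereSize₁-constant x y = trans (≡degree x) (trans (degree-constant x y) (sym (≡degree y)))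
    where
    ≡degree : ∀ x → sphereSize 1 x ≡ degree x
    ≡degree x = sum-cong-≗ λ y → *-identityʳ (𝟙 (δ x y ≟ 1))

  -- The recurrence for the constant function 1 determines `α` times the new size from the two
  -- preceding sizes, and `α` is positive.
  sphereSize-step : ∀ {j} → suc (suc j) ≤ d → ∀ x y → sphereSize (suc j) x ≡ sphereSize (suc j) y →
                    sphereSize j x ≡ sphereSize j y → sphereSize (suc (suc j)) x ≡ sphereSize (suc (suc j)) y
  sphereSize-step {j} 2+j≤d x y k₁₊ⱼ kⱼ =
    *-cancelˡ-≡ _ _ α {{>-nonZero α-positive}} (+-cancelʳ-≡ (β * k (suc j) x) _ _ (+-cancelʳ-≡ (γ * k j x) _ _ (begin
      α * k (suc (suc j)) x + β * k (suc j) x + γ * k j x ≡⟨ recurrence _ x ⟨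
      sphereSum (suc j) (k 1) x                           ≡⟨ sphereSum-constant (suc j) k₁≡ x ⟩
      k (suc j) x * k 1 basepoint                         ≡⟨ cong (_* k 1 basepoint) k₁₊ⱼ ⟩
      k (suc j) y * k 1 basepoint                         ≡⟨ sphereSum-constant (suc j) k₁≡ y ⟨
      sphereSum (suc j) (k 1) y                           ≡⟨ recurrence _ y ⟩
      α * k (suc (suc j)) y + β * k (suc j) y + γ * k j y ≡⟨ cong₂ (λ s t → α * k (suc (suc j)) y + β * s + γ * t) k₁₊ⱼ kⱼ ⟨
      α * k (suc (suc j)) y + β * k (suc j) x + γ * k j x ∎)))
    where
    open ≡-Reasoning
    open ThreeTerm (threeTerm 2+j≤d)
    k : ℕ → Fin n → ℕ
    k = sphereSize
    k₁≡ : ∀ z → k 1 z ≡ k 1 basepoint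
    k₁≡ z = sphereSize₁-constant z basepoint

  sphereSize-constant : ∀ j → j ≤ d → ∀ x y → sphereSize j x ≡ sphereSize j y
  sphereSize-constant zero          _     x y = trans (sphereSum-zero _ x) (sym (sphereSum-zero _ y))
  sphereSize-constant (suc zero)    _     x y = sphereSize₁-constant x y
  sphereSize-constant (suc (suc j)) 2+j≤d x y = sphereSize-step 2+j≤d x y
    (sphereSize-constant (suc j) (≤-trans (n≤1+n _) 2+j≤d) x y)
    (sphereSize-constant j (≤-trans (m≤n+m j 2) 2+j≤d) x y)

-- Integer differences, which remove additive constants.

Δ : ∀ {n} → (Fin n → ℕ) → Fin n → Fin n → ℤ
Δ g x y = pos (g x) ℤ.- pos (g y)

-- The values `s` belong to one vertex and `t` to another. Subtracting the two sides of the
-- hypothesis in the integers isolates the leading difference.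
Δ-recurrence : ∀ ε α β γ {s₀ s₁ s₂ t₀ t₁ t₂} →
  ε * s₁ + (α * s₂ + β * s₁ + γ * s₀) ≡ ε * t₁ + (α * t₂ + β * t₁ + γ * t₀) →
  pos α ℤ.* (pos s₂ ℤ.- pos t₂) ≡
  ℤ.- ((pos ε ℤ.+ pos β) ℤ.* (pos s₁ ℤ.- pos t₁)) ℤ.- pos γ ℤ.* (pos s₀ ℤ.- pos t₀)
Δ-recurrence ε α β γ {s₀} {s₁} {s₂} {t₀} {t₁} {t₂} eq = begin
  pos α ℤ.* (pos s₂ ℤ.- pos t₂)
    ≡⟨ isolate (pos ε) (pos α) (pos β) (pos γ) (pos s₀) (pos s₁) (pos s₂) (pos t₀) (pos t₁) (pos t₂) ⟩
  (L s₀ s₁ s₂ ℤ.- L t₀ t₁ t₂) ℤ.+ rhs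
    ≡⟨ cong (ℤ._+ rhs) (ℤ.i≡j⇒i-j≡0 (trans (sym (pos-L s₀ s₁ s₂)) (trans (cong pos eq) (pos-L t₀ t₁ t₂)))) ⟩
  pos 0 ℤ.+ rhs
    ≡⟨ ℤ.+-identityˡ rhs ⟩
  rhs ∎
  where
  open ≡-Reasoning
  rhs : ℤ
  rhs = ℤ.- ((pos ε ℤ.+ pos β) ℤ.* (pos s₁ ℤ.- pos t₁)) ℤ.- pos γ ℤ.* (pos s₀ ℤ.- pos t₀)
  L : ℕ → ℕ → ℕ → ℤ
  L u₀ u₁ u₂ = pos ε ℤ.* pos u₁ ℤ.+ (pos α ℤ.* pos u₂ ℤ.+ pos β ℤ.* pos u₁ ℤ.+ pos γ ℤ.* pos u₀)
  pos-L : ∀ u₀ u₁ u₂ → pos (ε * u₁ + (α * u₂ + β * u₁ + γ * u₀)) ≡ L u₀ u₁ u₂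
  pos-L u₀ u₁ u₂ = trans (ℤ.pos-+ (ε * u₁) _) (cong₂ ℤ._+_ (ℤ.pos-* ε u₁)
    (trans (ℤ.pos-+ (α * u₂ + β * u₁) _) (cong₂ ℤ._+_
      (trans (ℤ.pos-+ (α * u₂) _) (cong₂ ℤ._+_ (ℤ.pos-* α u₂) (ℤ.pos-* β u₁))) (ℤ.pos-* γ u₀))))
  isolate : ∀ ε α β γ s₀ s₁ s₂ t₀ t₁ t₂ → α ℤ.* (s₂ ℤ.- t₂) ≡
    ((ε ℤ.* s₁ ℤ.+ (α ℤ.* s₂ ℤ.+ β ℤ.* s₁ ℤ.+ γ ℤ.* s₀)) ℤ.- (ε ℤ.* t₁ ℤ.+ (α ℤ.* t₂ ℤ.+ β ℤ.* t₁ ℤ.+ γ ℤ.* t₀)))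
    ℤ.+ (ℤ.- ((ε ℤ.+ β) ℤ.* (s₁ ℤ.- t₁)) ℤ.- γ ℤ.* (s₀ ℤ.- t₀))
  isolate = ℤSolver.solve-∀

-- Injective functions with constant neighbourhood sums.

module MagicFunction {n} (G : Graph n) (d : ℕ) (isDR : IsDistanceRegular G d)
                     (isADC : IsAntipodalDoubleCover G d) (1≤d : 1 ≤ d)
                     (f : Fin n → ℕ) (f-injective : ∀ {x y} → f x ≡ f y → x ≡ y) where
  open AntipodalDoubleCover G d isDR isADC

  S : ℕ → Fin n → ℕ
  S j = sphereSum j f

  Proportional : ℕ → ℤ → (Fin n → ℕ) → Set
  Proportional p q g = ∀ x y → pos p ℤ.* Δ g x y ≡ q ℤ.* Δ f x y

  -- Compare x with its antipode: Δ (f ∘ σ) x (σ x) = - Δ f x (σ x), which is nonzero.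
  ratio-at-diameter : ∀ p q → Proportional p q (S d) → q ≡ ℤ.- pos p
  ratio-at-diameter p q prop = ℤ.*-cancelʳ-≡ q (ℤ.- pos p) D {{D≢0}} (begin
    q ℤ.* D                  ≡⟨ prop x (σ x) ⟨
    pos p ℤ.* Δ (S d) x (σ x) ≡⟨ cong₂ (λ s t → pos p ℤ.* (pos s ℤ.- pos t)) (sphereSum-diameter f x)
                                   (trans (sphereSum-diameter f (σ x)) (cong f (σ-involutive x))) ⟩
    pos p ℤ.* (pos (f (σ x)) ℤ.- pos (f x)) ≡⟨ flip (pos p) (pos (f x)) (pos (f (σ x))) ⟩
    ℤ.- pos p ℤ.* D          ∎)
    where
    open ≡-Reasoning
    x : Fin n
    x = basepoint
    D : ℤ
    D = Δ f x (σ x)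
    flip : ∀ p s t → p ℤ.* (t ℤ.- s) ≡ ℤ.- p ℤ.* (s ℤ.- t)
    flip = ℤSolver.solve-∀
    x≢σx : x ≢ σ x
    x≢σx eq = <-irrefl (trans (sym (δ-refl x)) (trans (cong (δ x) eq) (δ-σ x))) 1≤d
    D≢0 : ℤ.NonZero D
    D≢0 = ℤ.≢-nonZero λ D≡0 → x≢σx (f-injective (ℤ.+-injective (ℤ.i-j≡0⇒i≡j _ _ D≡0)))

  module _ {ε κ} (magic : ∀ x → ε * f x + S 1 x ≡ κ) where

    Δ-S₁ : ∀ x y → Δ (S 1) x y ≡ ℤ.- pos ε ℤ.* Δ f x y
    Δ-S₁ x y = begin
      Δ (S 1) x y                        ≡⟨ ℤ.*-identityˡ _ ⟨
      -- The magic equation itself is read as a recurrence with leading coefficient 1, middle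
      -- coefficient `ε` and last coefficient 0.
      pos 1 ℤ.* Δ (S 1) x y               ≡⟨ Δ-recurrence 0 1 ε 0 {0} {f x} {S 1 x} {0} {f y} {S 1 y} eq ⟩
      ℤ.- ((pos 0 ℤ.+ pos ε) ℤ.* Δ f x y) ℤ.- pos 0 ℤ.* pos 0 ≡⟨ tidy (pos ε) (Δ f x y) ⟩
      ℤ.- pos ε ℤ.* Δ f x y               ∎
      where
      open ≡-Reasoning
      tidy : ∀ e D → ℤ.- ((pos 0 ℤ.+ e) ℤ.* D) ℤ.- pos 0 ℤ.* pos 0 ≡ ℤ.- e ℤ.* D
      tidy = ℤSolver.solve-∀
      shape : ∀ e s t → 1 * t + e * s + 0 ≡ e * s + t
      shape = ℕSolver.solve-∀
      eq : 1 * S 1 x + ε * f x + 0 ≡ 1 * S 1 y + ε * f y + 0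
      eq = trans (shape ε (f x) (S 1 x)) (trans (trans (magic x) (sym (magic y))) (sym (shape ε (f y) (S 1 y))))

    module _ {j} (2+j≤d : suc (suc j) ≤ d) where
      open ThreeTerm (threeTerm 2+j≤d)

      -- Summing the magic equation over the sphere of radius `j + 1` gives
      -- `sphereSize (suc j) x * κ`, which does not depend on `x`.
      Δ-S : ∀ x y → pos α ℤ.* Δ (S (suc (suc j))) x y ≡
            ℤ.- ((pos ε ℤ.+ pos β) ℤ.* Δ (S (suc j)) x y) ℤ.- pos γ ℤ.* Δ (S j) x y
      Δ-S x y = Δ-recurrence ε α β γ (trans (value x) (trans
        (cong (_* κ) (sphereSize-constant (suc j) (≤-trans (n≤1+n _) 2+j≤d) x y)) (sym (value y))))
        where
        value : ∀ x → ε * S (suc j) x + (α * S (suc (suc j)) x + β * S (suc j) x + γ * S j x) ≡ sphereSize (suc j) x * κ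
        value x = trans (cong (λ t → ε * S (suc j) x + t) (sym (recurrence f x)))
          (trans (sym (sphereSum-linear (suc j) ε f (S 1) x)) (sphereSum-constant (suc j) magic x))

    proportional : ∀ j → j ≤ d → ∃ λ p → ∃ λ q → 0 < p × Proportional p q (S j)
    proportional zero _ = 1 , pos 1 , z<s , λ x y →
      cong₂ (λ s t → pos 1 ℤ.* (pos s ℤ.- pos t)) (sphereSum-zero f x) (sphereSum-zero f y)
    proportional (suc zero) _ = 1 , ℤ.- pos ε , z<s , λ x y → trans (ℤ.*-identityˡ _) (Δ-S₁ x y)
    proportional (suc (suc j)) 2+j≤d
      with proportional (suc j) (≤-trans (n≤1+n _) 2+j≤d) | proportional j (≤-trans (m≤n+m j 2) 2+j≤d)
    ... | p₁ , q₁ , 0<p₁ , prop₁ | p₀ , q₀ , 0<p₀ , prop₀ =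
      -- Multiplying `Δ-S` by `p₁ * p₀` clears both earlier denominators; the resulting coefficient
      -- of `Δ f` is the new numerator.
      p₁ * p₀ * α ,
      ℤ.- ((pos ε ℤ.+ pos β) ℤ.* pos p₀ ℤ.* q₁) ℤ.- pos γ ℤ.* pos p₁ ℤ.* q₀ ,
      *-mono-< (*-mono-< 0<p₁ 0<p₀) α-positive ,
      λ x y → begin
        pos (p₁ * p₀ * α) ℤ.* Δ (S (suc (suc j))) x y
          ≡⟨ cong (ℤ._* Δ (S (suc (suc j))) x y) (trans (ℤ.pos-* (p₁ * p₀) α) (cong (ℤ._* pos α) (ℤ.pos-* p₁ p₀))) ⟩
        pos p₁ ℤ.* pos p₀ ℤ.* pos α ℤ.* Δ (S (suc (suc j))) x y
          ≡⟨ ℤ.*-assoc (pos p₁ ℤ.* pos p₀) (pos α) _ ⟩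
        pos p₁ ℤ.* pos p₀ ℤ.* (pos α ℤ.* Δ (S (suc (suc j))) x y)
          ≡⟨ cong (pos p₁ ℤ.* pos p₀ ℤ.*_) (Δ-S 2+j≤d x y) ⟩
        pos p₁ ℤ.* pos p₀ ℤ.* (ℤ.- ((pos ε ℤ.+ pos β) ℤ.* Δ (S (suc j)) x y) ℤ.- pos γ ℤ.* Δ (S j) x y)
          ≡⟨ regroup (pos p₁) (pos p₀) (pos ε ℤ.+ pos β) (pos γ) _ _ ⟩
        ℤ.- ((pos ε ℤ.+ pos β) ℤ.* pos p₀ ℤ.* (pos p₁ ℤ.* Δ (S (suc j)) x y)) ℤ.- pos γ ℤ.* pos p₁ ℤ.* (pos p₀ ℤ.* Δ (S j) x y)
          ≡⟨ cong₂ (λ s t → ℤ.- ((pos ε ℤ.+ pos β) ℤ.* pos p₀ ℤ.* s) ℤ.- pos γ ℤ.* pos p₁ ℤ.* t) (prop₁ x y) (prop₀ x y) ⟩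
        ℤ.- ((pos ε ℤ.+ pos β) ℤ.* pos p₀ ℤ.* (q₁ ℤ.* Δ f x y)) ℤ.- pos γ ℤ.* pos p₁ ℤ.* (q₀ ℤ.* Δ f x y)
          ≡⟨ collect ((pos ε ℤ.+ pos β) ℤ.* pos p₀) (pos γ ℤ.* pos p₁) q₁ q₀ (Δ f x y) ⟩
        (ℤ.- ((pos ε ℤ.+ pos β) ℤ.* pos p₀ ℤ.* q₁) ℤ.- pos γ ℤ.* pos p₁ ℤ.* q₀) ℤ.* Δ f x y ∎
      where
      open ≡-Reasoning
      open ThreeTerm (threeTerm 2+j≤d)
      regroup : ∀ p₁ p₀ e c s t → p₁ ℤ.* p₀ ℤ.* (ℤ.- (e ℤ.* s) ℤ.- c ℤ.* t) ≡
                ℤ.- (e ℤ.* p₀ ℤ.* (p₁ ℤ.* s)) ℤ.- c ℤ.* p₁ ℤ.* (p₀ ℤ.* t)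
      regroup = ℤSolver.solve-∀
      collect : ∀ e c q₁ q₀ D → ℤ.- (e ℤ.* (q₁ ℤ.* D)) ℤ.- c ℤ.* (q₀ ℤ.* D) ≡ (ℤ.- (e ℤ.* q₁) ℤ.- c ℤ.* q₀) ℤ.* D
      collect = ℤSolver.solve-∀

    -- At radius `d` the sphere sum is `f ∘ σ` and the ratio is -1, so after cancelling `p` its
    -- differences are the negatives of those of `f`.
    Δf+Δf∘σ≡0 : ∀ x y → Δ f x y ℤ.+ Δ f (σ x) (σ y) ≡ pos 0
    Δf+Δf∘σ≡0 x y with proportional d ≤-refl
    ... | p , q , 0<p , prop = ℤ.*-cancelˡ-≡ (pos p) _ _ {{p≢0}} (begin
      pos p ℤ.* (Δ f x y ℤ.+ Δ f (σ x) (σ y))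
        ≡⟨ ℤ.*-distribˡ-+ (pos p) (Δ f x y) _ ⟩
      pos p ℤ.* Δ f x y ℤ.+ pos p ℤ.* Δ f (σ x) (σ y)
        ≡⟨ cong₂ (λ s t → pos p ℤ.* Δ f x y ℤ.+ pos p ℤ.* (pos s ℤ.- pos t)) (sphereSum-diameter f x) (sphereSum-diameter f y) ⟨
      pos p ℤ.* Δ f x y ℤ.+ pos p ℤ.* Δ (S d) x y
        ≡⟨ cong (λ t → pos p ℤ.* Δ f x y ℤ.+ t) (trans (prop x y) (cong (ℤ._* Δ f x y) (ratio-at-diameter p q prop))) ⟩
      pos p ℤ.* Δ f x y ℤ.+ ℤ.- pos p ℤ.* Δ f x y
        ≡⟨ cancel (pos p) (Δ f x y) ⟩
      pos p ℤ.* pos 0 ∎)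
      where
      open ≡-Reasoning
      cancel : ∀ p D → p ℤ.* D ℤ.+ ℤ.- p ℤ.* D ≡ p ℤ.* pos 0
      cancel = ℤSolver.solve-∀
      p≢0 : ℤ.NonZero (pos p)
      p≢0 = >-nonZero 0<p

    -- The second sum at `x` is `S j (σ x)`. The difference of the totals, scaled by `p`, is `q`
    -- times the difference of `f + f ∘ σ`, which is 0.
    complementary-sums-constant : ∀ {j} → j ≤ d → ∀ x y → S j x + S (d ∸ j) x ≡ S j y + S (d ∸ j) y
    complementary-sums-constant {j} j≤d x y with proportional j j≤d
    ... | p , q , 0<p , prop = ℤ.+-injective (ℤ.i-j≡0⇒i≡j _ _ (begin
      pos (S j x + S (d ∸ j) x) ℤ.- pos (S j y + S (d ∸ j) y)
        ≡⟨ cong₂ (λ s t → pos (S j x + s) ℤ.- pos (S j y + t)) (sphereSum-complement j≤d f x) (sphereSum-complement j≤d f y) ⟩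
      pos (S j x + S j (σ x)) ℤ.- pos (S j y + S j (σ y))
        ≡⟨ cong₂ ℤ._-_ (ℤ.pos-+ (S j x) _) (ℤ.pos-+ (S j y) _) ⟩
      (pos (S j x) ℤ.+ pos (S j (σ x))) ℤ.- (pos (S j y) ℤ.+ pos (S j (σ y)))
        ≡⟨ pair (pos (S j x)) (pos (S j (σ x))) (pos (S j y)) (pos (S j (σ y))) ⟩
      Δ (S j) x y ℤ.+ Δ (S j) (σ x) (σ y)
        ≡⟨ ℤ.*-cancelˡ-≡ (pos p) _ _ {{>-nonZero 0<p}} scaled ⟩
      pos 0 ∎))
      where
      open ≡-Reasoning
      pair : ∀ a b c e → (a ℤ.+ b) ℤ.- (c ℤ.+ e) ≡ (a ℤ.- c) ℤ.+ (b ℤ.- e)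
      pair = ℤSolver.solve-∀
      scaled : pos p ℤ.* (Δ (S j) x y ℤ.+ Δ (S j) (σ x) (σ y)) ≡ pos p ℤ.* pos 0
      scaled = begin
        pos p ℤ.* (Δ (S j) x y ℤ.+ Δ (S j) (σ x) (σ y)) ≡⟨ ℤ.*-distribˡ-+ (pos p) (Δ (S j) x y) _ ⟩
        pos p ℤ.* Δ (S j) x y ℤ.+ pos p ℤ.* Δ (S j) (σ x) (σ y) ≡⟨ cong₂ ℤ._+_ (prop x y) (prop (σ x) (σ y)) ⟩
        q ℤ.* Δ f x y ℤ.+ q ℤ.* Δ f (σ x) (σ y) ≡⟨ ℤ.*-distribˡ-+ q (Δ f x y) _ ⟨
        q ℤ.* (Δ f x y ℤ.+ Δ f (σ x) (σ y)) ≡⟨ cong (q ℤ.*_) (Δf+Δf∘σ≡0 x y) ⟩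
        q ℤ.* pos 0 ≡⟨ trans (ℤ.*-zeroʳ q) (sym (ℤ.*-zeroʳ (pos p))) ⟩
        pos p ℤ.* pos 0 ∎

  -- Signs of the ratios in the bipartite case.

  module _ (bipartite : IsBipartite G) {κ} (magic : ∀ x → S 1 x ≡ κ) where

    -- `β` counts neighbours of `u` as far from `basepoint` as `u` itself. Walks of equal length
    -- would give such a neighbour the colour of `u`.
    β≡0 : ∀ {j} (t : ThreeTerm j) → ThreeTerm.β t ≡ 0
    β≡0 t with ThreeTerm.β-count t
    ... | u , δu , count≡β = trans (sym count≡β) (count-zero λ y δuy≡1 δy →
      proj₂ bipartite (δ≡1⇒adj δuy≡1) (colour-endpoints (proj₁ bipartite) (proj₂ bipartite) refl
        (proj₁ (δ≡⇒distance δu)) (proj₁ (δ≡⇒distance δy))))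

    -- With `ε` and `β` both 0, the recurrence links radius `j + 2` to radius `j` alone and
    -- multiplies the ratio by `- γ / α`.
    proportional-step : ∀ j p q → suc (suc j) ≤ d → 0 < p → Proportional p q (S j) →
      ∃ λ p′ → ∃ λ c → 0 < p′ × Proportional p′ (ℤ.- (pos c ℤ.* q)) (S (suc (suc j)))
    proportional-step j p q 2+j≤d 0<p prop = p * α , γ , *-mono-< 0<p α-positive , λ x y → begin
      pos (p * α) ℤ.* Δ (S (suc (suc j))) x y
        ≡⟨ cong (ℤ._* Δ (S (suc (suc j))) x y) (ℤ.pos-* p α) ⟩
      pos p ℤ.* pos α ℤ.* Δ (S (suc (suc j))) x y
        ≡⟨ ℤ.*-assoc (pos p) (pos α) _ ⟩
      pos p ℤ.* (pos α ℤ.* Δ (S (suc (suc j))) x y)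
        ≡⟨ cong (pos p ℤ.*_) (Δ-S {0} magic 2+j≤d x y) ⟩
      pos p ℤ.* (ℤ.- ((pos 0 ℤ.+ pos β) ℤ.* Δ (S (suc j)) x y) ℤ.- pos γ ℤ.* Δ (S j) x y)
        ≡⟨ cong (λ b → pos p ℤ.* (ℤ.- ((pos 0 ℤ.+ pos b) ℤ.* Δ (S (suc j)) x y) ℤ.- pos γ ℤ.* Δ (S j) x y))
             (β≡0 (threeTerm 2+j≤d)) ⟩
      pos p ℤ.* (ℤ.- ((pos 0 ℤ.+ pos 0) ℤ.* Δ (S (suc j)) x y) ℤ.- pos γ ℤ.* Δ (S j) x y)
        ≡⟨ regroup (pos p) (pos γ) (Δ (S (suc j)) x y) (Δ (S j) x y) ⟩
      ℤ.- (pos γ ℤ.* (pos p ℤ.* Δ (S j) x y))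
        ≡⟨ cong (λ t → ℤ.- (pos γ ℤ.* t)) (prop x y) ⟩
      ℤ.- (pos γ ℤ.* (q ℤ.* Δ f x y))
        ≡⟨ collect (pos γ) q (Δ f x y) ⟩
      ℤ.- (pos γ ℤ.* q) ℤ.* Δ f x y ∎
      where
      open ≡-Reasoning
      open ThreeTerm (threeTerm 2+j≤d)
      regroup : ∀ p c s t → p ℤ.* (ℤ.- ((pos 0 ℤ.+ pos 0) ℤ.* s) ℤ.- c ℤ.* t) ≡ ℤ.- (c ℤ.* (p ℤ.* t))
      regroup = ℤSolver.solve-∀
      collect : ∀ c q D → ℤ.- (c ℤ.* (q ℤ.* D)) ≡ ℤ.- (c ℤ.* q) ℤ.* D
      collect = ℤSolver.solve-∀

    -- The numerator may be 0, which is what happens at odd radii.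
    NonNegativeRatio : ℕ → Set
    NonNegativeRatio j = ∃ λ p → ∃ λ m → 0 < p × Proportional p (pos m) (S j)

    -- Two steps of length 2 multiply the numerator by `- c₂` and then by `- c₄`, so the signs
    -- cancel.
    nonNegative-step : ∀ {j} → 4 + j ≤ d → NonNegativeRatio j → NonNegativeRatio (4 + j)
    nonNegative-step {j} 4+j≤d (p , m , 0<p , prop) =
      let p₂ , c₂ , 0<p₂ , prop₂ = proportional-step j p (pos m) (≤-trans (m≤n+m (2 + j) 2) 4+j≤d) 0<p prop
          p₄ , c₄ , 0<p₄ , prop₄ = proportional-step (2 + j) p₂ (ℤ.- (pos c₂ ℤ.* pos m)) 4+j≤d 0<p₂ prop₂
      in p₄ , c₄ * (c₂ * m) , 0<p₄ , λ x y → trans (prop₄ x y) (cong (ℤ._* Δ f x y) (sign c₂ c₄))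
      where
      double-negation : ∀ a b → ℤ.- (a ℤ.* (ℤ.- b)) ≡ a ℤ.* b
      double-negation = ℤSolver.solve-∀
      sign : ∀ c₂ c₄ → ℤ.- (pos c₄ ℤ.* (ℤ.- (pos c₂ ℤ.* pos m))) ≡ pos (c₄ * (c₂ * m))
      sign c₂ c₄ = trans (double-negation (pos c₄) (pos c₂ ℤ.* pos m))
        (sym (trans (ℤ.pos-* c₄ (c₂ * m)) (cong (pos c₄ ℤ.*_) (ℤ.pos-* c₂ m))))

    -- The base case is conditional on `r ≤ d`. In the form `k * 4 + r`, raising `k` by one adds 4
    -- definitionally.
    nonNegative-mod4 : ∀ {r} → (r ≤ d → NonNegativeRatio r) → ∀ k → k * 4 + r ≤ d → NonNegativeRatio (k * 4 + r)
    nonNegative-mod4 base zero    r≤d = base r≤d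
    nonNegative-mod4 base (suc k) le  =
      nonNegative-step le (nonNegative-mod4 base k (≤-trans (m≤n+m _ 4) le))

    -- The ratio at the diameter is -1, so a natural number would equal the negative of a positive
    -- one.
    ¬nonNegative-diameter : ¬ NonNegativeRatio d
    ¬nonNegative-diameter (suc p , m , _ , prop) with ratio-at-diameter (suc p) (pos m) prop
    ... | ()

    nonNegative₀ : NonNegativeRatio 0
    nonNegative₀ = 1 , 1 , z<s , λ x y →
      cong₂ (λ s t → pos 1 ℤ.* (pos s ℤ.- pos t)) (sphereSum-zero f x) (sphereSum-zero f y)

    proportional₁ : Proportional 1 (pos 0) (S 1)
    proportional₁ x y = trans (ℤ.*-identityˡ _) (Δ-S₁ {0} magic x y)

    -- The ratio 0 at radius 1 stays 0, because a step only multiplies the numerator.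
    nonNegative₃ : 3 ≤ d → NonNegativeRatio 3
    nonNegative₃ 3≤d =
      let p , c , 0<p , prop = proportional-step 1 1 (pos 0) 3≤d z<s proportional₁
      in p , 0 , 0<p , λ x y → trans (prop x y) (cong (λ q → ℤ.- q ℤ.* Δ f x y) (ℤ.*-zeroʳ (pos c)))

    diameter-mod4 : d % 4 ≡ 2
    diameter-mod4 = cases (d % 4) (m%n<n d 4) (trans (m≡m%n+[m/n]*n d 4) (+-comm (d % 4) _))
      where
      -- A nonnegative ratio at a residue `r` propagates in steps of 4 up to `d`, where it is
      -- excluded.
      impossible : ∀ {r} → (r ≤ d → NonNegativeRatio r) → d ≢ d / 4 * 4 + r
      impossible base eq = ¬nonNegative-diameter
        (subst NonNegativeRatio (sym eq) (nonNegative-mod4 base (d / 4) (≤-reflexive (sym eq))))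
      cases : ∀ r → r < 4 → d ≡ d / 4 * 4 + r → r ≡ 2
      cases 0 _ eq = contradiction eq (impossible λ _ → nonNegative₀)
      cases 1 _ eq = contradiction eq (impossible λ _ → 1 , 0 , z<s , proportional₁)
      cases 2 _ _  = refl
      cases 3 _ eq = contradiction eq (impossible nonNegative₃)
      cases (suc (suc (suc (suc _)))) (s≤s (s≤s (s≤s (s≤s ())))) _

-- From functions on the vertices to magic labelings.

theorem2p7 : ∀ {n} (G : Graph n) (d : ℕ) →
    IsDistanceRegular G d → IsAntipodalDoubleCover G d → (l : Labeling n) →
    (IsDistanceMagic G l ⊎ IsClosedDistanceMagic G l →
    ∀ j → j ≤ d → IsMagic G (j ∷ (d ∸ j) ∷ []) l)
    × (1 ≤ d → IsBipartite G → IsDistanceMagic G l → d % 4 ≡ 2)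
theorem2p7 {n} G d isDR isADC l = magic-pairs , λ 1≤d bipartite (κ , magic) →
  MagicFunction.diameter-mod4 G d isDR isADC 1≤d f f-injective bipartite
    λ x → trans (sym (neighbourhood-sum₁ 1 f x)) (magic x)
  where
  open AntipodalDoubleCover G d isDR isADC
  f : Fin n → ℕ
  f = label l
  f-injective : ∀ {x y} → f x ≡ f y → x ≡ y
  f-injective eq = Bijection.injective l (Fin.toℕ-injective (suc-injective eq))

  constant-sums : 1 ≤ d → IsDistanceMagic G l ⊎ IsClosedDistanceMagic G l → ∀ {j} → j ≤ d →
    ∀ x y → sphereSum j f x + sphereSum (d ∸ j) f x ≡ sphereSum j f y + sphereSum (d ∸ j) f y
  -- A distance magic labeling is the case `ε = 0`.
  constant-sums 1≤d (inj₁ (κ , magic)) =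
    MagicFunction.complementary-sums-constant G d isDR isADC 1≤d f f-injective {0} {κ}
      λ x → trans (sym (neighbourhood-sum₁ 1 f x)) (magic x)
  -- A closed distance magic labeling is the case `ε = 1`, as `f x` is the sphere sum of radius 0.
  constant-sums 1≤d (inj₂ (κ , magic)) =
    MagicFunction.complementary-sums-constant G d isDR isADC 1≤d f f-injective {1} {κ}
      λ x → trans (cong (_+ sphereSum 1 f x) (trans (*-identityˡ (f x)) (sym (sphereSum-zero f x))))
        (trans (sym (neighbourhood-sum₂-≢ (λ ()) f x)) (magic x))

  magic-pairs : IsDistanceMagic G l ⊎ IsClosedDistanceMagic G l → ∀ j → j ≤ d → IsMagic G (j ∷ (d ∸ j) ∷ []) l
  magic-pairs hyp j j≤d = w basepoint , λ x → w-constant x basepoint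
    where
    w : Fin n → ℕ
    w x = sumOver (neighbourhood G (j ∷ (d ∸ j) ∷ []) x) f
    w-constant : ∀ x y → w x ≡ w y
    w-constant x y with 1 ≤? d | j ≟ d ∸ j
    -- At diameter 0 any two vertices coincide.
    ... | no 1≰d | _ = cong w (δ≡0⇒≡ (n<1⇒n≡0 (≤-trans (s≤s (δ≤d x y)) (≰⇒> 1≰d))))
    ... | yes 1≤d | no j≢d∸j = trans (neighbourhood-sum₂-≢ j≢d∸j f x)
      (trans (constant-sums 1≤d hyp j≤d x y) (sym (neighbourhood-sum₂-≢ j≢d∸j f y)))
    -- Here the union is a single sphere while the constant total counts it twice, so the factor 2
    -- is cancelled.
    ... | yes 1≤d | yes j≡d∸j = trans (single x) (trans
      (*-cancelˡ-≡ _ _ 2 (trans (double x) (trans (constant-sums 1≤d hyp j≤d x y) (sym (double y)))))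
      (sym (single y)))
      where
      single : ∀ x → w x ≡ sphereSum j f x
      single x = trans (cong (λ i → sumOver (neighbourhood G (j ∷ i ∷ []) x) f) (sym j≡d∸j)) (neighbourhood-sum₂-≡ j f x)
      double : ∀ x → 2 * sphereSum j f x ≡ sphereSum j f x + sphereSum (d ∸ j) f x
      double x = cong (sphereSum j f x +_) (trans (+-identityʳ _) (cong (λ i → sphereSum i f x) j≡d∸j))
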